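{- Let $\mathcal A=(S,R_0)$ be an argumentation network with joint attacks, where $S\neq\varnothing$ and $R_0\subseteq(2^S\setminus\{\varnothing\})\times S$, such that every $x\in S$ is attacked by finitely many sets $G$ (with $GR_0x$) and every such $G$ is finite. Regard the elements of $S$ as atoms of $\mathbf{CN}$ and let $\Delta_{\mathcal A}$ consist of the following formulas for every $x\in S$: $$(\textstyle\bigvee_{GR_0x}\bigwedge_{z\in G}z)\to Nx,\qquad x\leftrightarrow \bigwedge_{GR_0x}\bigvee_{z\in G}Nz,$$ $$\textstyle\bigwedge_{GR_0x}(\bigvee_{z\in G}\neg z)\wedge\bigl(\bigvee_{GR_0x}\bigwedge_{z\in G}(z\vee\neg Nz)\bigr)\to\neg x\wedge\neg Nx$$ (empty conjunction $\top$, empty disjunction $\bot$). Then the $\mathbf{CN}$-models of $\Delta_{\mathcal A}$ correspond exactly to the legitimate Caminada–Gabbay labellings of $\mathcal A$: for every $\mathbf{CN}$-model $h$ of $\Delta_{\mathcal A}$, the map $\lambda_h$ with $\lambda_h(x)=\mathrm{in}$ if $h(x)=1$, $\mathrm{out}$ if $h(Nx)=1$, $\mathrm{und}$ if $h(x)=h(Nx)=0$ is a legitimate Caminada–Gabbay labelling; and for every legitimate Caminada–Gabbay labelling $\lambda$, the assignment $h_\lambda$ with $h_\lambda(x)=1$ iff $\lambda(x)=\mathrm{in}$ and $h_\lambda(Nx)=1$ iff $\lambda(x)=\mathrm{out}$ is a $\mathbf{CN}$-model of $\Delta_{\mathcal A}$.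
   Context: The logic $\mathbf{CN}$: atomic formulas are $q$ and $Nq$ for basic atoms $q$; formulas use classical connectives; a $\mathbf{CN}$-model is a classical $\{0,1\}$-assignment $h$ to all atoms $q,Nq$ with $h(Nq)=1\Rightarrow h(q)=0$, with classical satisfaction. A legitimate Caminada–Gabbay labelling of $(S,R_0)$ is $\lambda:S\to\{\mathrm{in},\mathrm{out},\mathrm{und}\}$ such that for each $x$: (CG1) $\lambda(x)=\mathrm{in}$ iff either $x$ is attacked by no $G$, or for every $G$ with $GR_0x$ there is $y\in G$ with $\lambda(y)=\mathrm{out}$; (CG2) $\lambda(x)=\mathrm{out}$ iff for some $G$ with $GR_0x$, all $y\in G$ have $\lambda(y)=\mathrm{in}$; (CG3) $\lambda(x)=\mathrm{und}$ iff for every $G$ with $GR_0x$ there is $y\in G$ with $\lambda(y)\neq\mathrm{in}$, and for some $G'$ with $G'R_0x$ every $y\in G'$ has $\lambda(y)\in\{\mathrm{in},\mathrm{und}\}$. -}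

module Defs where

open import Level using (Level; _⊔_) renaming (suc to lsuc)
open import Data.Bool.Base using (Bool; true; false; not; if_then_else_) renaming (_∧_ to _∧ᵇ_; _∨_ to _∨ᵇ_)
open import Data.List.Base using (List; map; foldr)
open import Data.List.Membership.Propositional using () renaming (_∈_ to _∈ˡ_)
open import Data.List.Relation.Unary.Any using (Any)
open import Data.Product.Base using (∃; _×_; _,_; proj₁)
open import Data.Sum.Base using (_⊎_)
open import Function.Bundles using (_⇔_)
open import Relation.Binary.Core using (REL)
open import Relation.Binary.PropositionalEquality using (_≡_; _≢_)
open import Relation.Nullary.Negation using (¬_)
open import Relation.Unary using (Pred; _∈_; _≐_; Satisfiable)

private
  variable
    a ℓ r : Level
    Q : Set a

------------------------------------------------------------------------
-- The logic CN

infix  9 ~_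
infixr 7 _∧_
infixr 6 _∨_
infixr 5 _⇒_
infix  4 _⇔ᶠ_ _⊨_

data Atom (Q : Set a) : Set a where
  pos : Q → Atom Q
  N   : Q → Atom Q

data Formula (Q : Set a) : Set a where
  atom                 : Atom Q → Formula Q
  ⊤ᶠ ⊥ᶠ                : Formula Q
  ~_                   : Formula Q → Formula Q
  _∧_ _∨_ _⇒_ _⇔ᶠ_     : Formula Q → Formula Q → Formula Q

⋀ ⋁ : List (Formula Q) → Formula Q
⋀ = foldr _∧_ ⊤ᶠ
⋁ = foldr _∨_ ⊥ᶠ

Assignment : Set a → Set a
Assignment Q = Atom Q → Bool

⟦_⟧ : Formula Q → Assignment Q → Bool
⟦ atom p ⟧ h = h p
⟦ ⊤ᶠ     ⟧ h = true
⟦ ⊥ᶠ     ⟧ h = false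
⟦ ~ φ    ⟧ h = not (⟦ φ ⟧ h)
⟦ φ ∧ ψ  ⟧ h = ⟦ φ ⟧ h ∧ᵇ ⟦ ψ ⟧ h
⟦ φ ∨ ψ  ⟧ h = ⟦ φ ⟧ h ∨ᵇ ⟦ ψ ⟧ h
⟦ φ ⇒ ψ  ⟧ h = not (⟦ φ ⟧ h) ∨ᵇ ⟦ ψ ⟧ h
⟦ φ ⇔ᶠ ψ ⟧ h = if ⟦ φ ⟧ h then ⟦ ψ ⟧ h else not (⟦ ψ ⟧ h)

_⊨_ : Assignment Q → Formula Q → Set
h ⊨ φ = ⟦ φ ⟧ h ≡ true

IsCNModel : {Q : Set a} → Assignment Q → Set a
IsCNModel h = ∀ q → h (N q) ≡ true → h (pos q) ≡ false

_IsCNModelOf_ : {Q : Set a} → Assignment Q → Pred (Formula Q) ℓ → Set (a ⊔ ℓ)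
h IsCNModelOf Γ = IsCNModel h × (∀ φ → φ ∈ Γ → h ⊨ φ)

------------------------------------------------------------------------
-- Argumentation networks with joint attacks

-- Subsets of S are predicates, and two of them are the same set when they
-- are extensionally equal (≐); R₀-resp makes _R₀_ a relation on sets.

record JointAttackNetwork (a ℓ r : Level) : Set (lsuc (a ⊔ ℓ ⊔ r)) where
  infix 4 _R₀_
  field
    S           : Set a
    S-nonempty  : S
    _R₀_        : REL (Pred S ℓ) S r
    R₀-resp     : ∀ {G H x} → G ≐ H → G R₀ x → H R₀ x
    R₀-nonempty : ∀ {G x} → G R₀ x → Satisfiable G

  Attacker : S → Set (a ⊔ lsuc ℓ ⊔ r)
  Attacker x = ∃ λ G → G R₀ x

-- Finiteness is given by listings, possibly with repetitions; the formulas
-- of Δ below are built along them.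

record Finitary (𝒜 : JointAttackNetwork a ℓ r) : Set (lsuc (a ⊔ ℓ) ⊔ r) where
  open JointAttackNetwork 𝒜
  field
    attackers          : ∀ x → List (Attacker x)
    attackers-complete : ∀ {G x} → G R₀ x → Any (λ A → G ≐ proj₁ A) (attackers x)
    elements           : ∀ {G x} → G R₀ x → List S
    elements-correct   : ∀ {G x} (p : G R₀ x) → G ≐ (_∈ˡ elements p)

------------------------------------------------------------------------
-- The theory Δ of a network

module _ (𝒜 : JointAttackNetwork a ℓ r) (fin : Finitary 𝒜) where
  open JointAttackNetwork 𝒜
  open Finitary fin

  ⋀-attackers ⋁-attackers : (x : S) → (Attacker x → Formula S) → Formula S
  ⋀-attackers x f = ⋀ (map f (attackers x))
  ⋁-attackers x f = ⋁ (map f (attackers x))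

  ⋀-elements ⋁-elements : {x : S} → Attacker x → (S → Formula S) → Formula S
  ⋀-elements (_ , p) f = ⋀ (map f (elements p))
  ⋁-elements (_ , p) f = ⋁ (map f (elements p))

  data Δ : Pred (Formula S) a where
    out-axiom : ∀ x → Δ
      (⋁-attackers x (λ G → ⋀-elements G λ z → atom (pos z)) ⇒ atom (N x))
    in-axiom  : ∀ x → Δ
      (atom (pos x) ⇔ᶠ ⋀-attackers x (λ G → ⋁-elements G λ z → atom (N z)))
    und-axiom : ∀ x → Δ
      (   ⋀-attackers x (λ G → ⋁-elements G λ z → ~ atom (pos z))
        ∧ ⋁-attackers x (λ G → ⋀-elements G λ z → atom (pos z) ∨ ~ atom (N z))
      ⇒ ~ atom (pos x) ∧ ~ atom (N x))

------------------------------------------------------------------------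
-- Caminada–Gabbay labellings

data Label : Set where
  IN OUT UND : Label

record IsLegitimate (𝒜 : JointAttackNetwork a ℓ r)
                    (lab : JointAttackNetwork.S 𝒜 → Label) : Set (a ⊔ lsuc ℓ ⊔ r) where
  open JointAttackNetwork 𝒜
  field
    CG1 : ∀ x → lab x ≡ IN ⇔
            ((¬ (∃ λ G → G R₀ x)) ⊎
             (∀ G → G R₀ x → ∃ λ y → y ∈ G × lab y ≡ OUT))
    CG2 : ∀ x → lab x ≡ OUT ⇔
            (∃ λ G → G R₀ x × (∀ y → y ∈ G → lab y ≡ IN))
    CG3 : ∀ x → lab x ≡ UND ⇔
            ((∀ G → G R₀ x → ∃ λ y → y ∈ G × lab y ≢ IN) ×
             (∃ λ G′ → G′ R₀ x × (∀ y → y ∈ G′ → lab y ≡ IN ⊎ lab y ≡ UND)))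

------------------------------------------------------------------------
-- Passing between assignments and labellings

-- The first two cases exclude each other when h is a CN-model.
λ[_] : Assignment Q → Q → Label
λ[ h ] x = if h (pos x) then IN else if h (N x) then OUT else UND

isIN isOUT : Label → Bool
isIN IN  = true
isIN OUT = false
isIN UND = false
isOUT IN  = false
isOUT OUT = true
isOUT UND = false

h[_] : (Q → Label) → Assignment Q
h[ lab ] (pos x) = isIN  (lab x)
h[ lab ] (N x)   = isOUT (lab x)

{-# OPTIONS --safe #-}
module Submission where

-- h ↦ λ[ h ] and lab ↦ h[ lab ] are mutually inverse between CN-assignments and
-- labellings, so only assignments of the form h[ lab ] matter.  For these, the
-- three axioms at x are "some G ⊆ IN gives OUT", "IN iff every G meets OUT" and
-- "UND if every G meets ∁ IN and some G ⊆ ∁ OUT".  These are CG1 and the ⇐ halves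
-- of CG2 and CG3; the ⇒ halves follow since the three conditions on the attackers
-- are exhaustive, by finiteness, while the labels exclude each other.

open import Defs
open import Level using (Level)
open import Data.Bool.Base using (true; false; not; if_then_else_) renaming (_∧_ to _∧ᵇ_; _∨_ to _∨ᵇ_)
open import Data.List.Base using (List; []; _∷_; map)
open import Data.List.Membership.Propositional using (find; lose)
open import Data.List.Relation.Unary.All as All using (All; []; _∷_)
open import Data.List.Relation.Unary.All.Properties using (¬Any⇒All¬; ¬All⇒Any¬)
open import Data.List.Relation.Unary.Any as Any using (Any)
open import Data.Product.Base using (∃; _×_; _,_; proj₁; proj₂; uncurry)
open import Data.Sum.Base as Sum using (_⊎_; inj₁; inj₂)
open import Function.Base using (_∘_; id; case_of_)
open import Function.Bundles using (_⇔_; mk⇔; Equivalence)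
open import Relation.Binary.PropositionalEquality
  using (_≡_; _≢_; refl; sym; trans; cong; cong₂)
open import Relation.Nullary.Decidable using (Dec; yes; no; _because_; ¬?; decidable-stable)
open import Relation.Nullary.Negation using (contradiction)
open import Relation.Nullary.Reflects
  using (Reflects; ofʸ; ofⁿ; invert; det; ¬-reflects; _×-reflects_; _⊎-reflects_; _→-reflects_)
open import Relation.Unary using (Pred; Decidable; _∈_; _⊆_; ∁)

open Equivalence using (to; from)

private
  variable
    a b ℓ p q r : Level
    A : Set a
    B : Set b
    Q : Set a

-- Truth values reflecting propositions.

reflects-⇔ : ∀ {b} → A ⇔ B → Reflects A b → Reflects B b
reflects-⇔ A⇔B (ofʸ a)  = ofʸ (to A⇔B a)
reflects-⇔ A⇔B (ofⁿ ¬a) = ofⁿ (¬a ∘ from A⇔B)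

-- The Boolean here is the clause of `⟦_⟧` for `⇔ᶠ`, so the lemma applies directly to the in-axiom.
_⇔-reflects_ : ∀ {b c} → Reflects A b → Reflects B c →
               Reflects (A ⇔ B) (if b then c else not c)
ofʸ a  ⇔-reflects ofʸ b  = ofʸ (mk⇔ (λ _ → b) (λ _ → a))
ofʸ a  ⇔-reflects ofⁿ ¬b = ofⁿ λ A⇔B → ¬b (to A⇔B a)
ofⁿ ¬a ⇔-reflects ofʸ b  = ofⁿ λ A⇔B → ¬a (from A⇔B b)
ofⁿ ¬a ⇔-reflects ofⁿ ¬b = ofʸ (mk⇔ (λ a → contradiction a ¬a) (λ b → contradiction b ¬b))

reflects-true : ∀ {b} → Reflects A b → b ≡ true → A
reflects-true A-reflects refl = invert A-reflects

true-reflects : ∀ {b} → Reflects A b → A → b ≡ true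
true-reflects A-reflects a = det A-reflects (ofʸ a)

-- Stands in for function extensionality: `h[ λ[ h ] ]` and `h` are only known to agree atom by
-- atom, and satisfaction has to pass between them.
⟦_⟧-cong : (φ : Formula Q) {h h′ : Assignment Q} → (∀ q → h q ≡ h′ q) → ⟦ φ ⟧ h ≡ ⟦ φ ⟧ h′
⟦ atom q ⟧-cong h≗h′ = h≗h′ q
⟦ ⊤ᶠ     ⟧-cong h≗h′ = refl
⟦ ⊥ᶠ     ⟧-cong h≗h′ = refl
⟦ ~ φ    ⟧-cong h≗h′ = cong not (⟦ φ ⟧-cong h≗h′)
⟦ φ ∧ ψ  ⟧-cong h≗h′ = cong₂ _∧ᵇ_ (⟦ φ ⟧-cong h≗h′) (⟦ ψ ⟧-cong h≗h′)
⟦ φ ∨ ψ  ⟧-cong h≗h′ = cong₂ _∨ᵇ_ (⟦ φ ⟧-cong h≗h′) (⟦ ψ ⟧-cong h≗h′)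
⟦ φ ⇒ ψ  ⟧-cong h≗h′ = cong₂ (λ b c → not b ∨ᵇ c) (⟦ φ ⟧-cong h≗h′) (⟦ ψ ⟧-cong h≗h′)
⟦ φ ⇔ᶠ ψ ⟧-cong h≗h′ = cong₂ (λ b c → if b then c else not c) (⟦ φ ⟧-cong h≗h′) (⟦ ψ ⟧-cong h≗h′)

module _ {P : Pred A p} {f : A → Formula Q} {h : Assignment Q}
         (f-reflects : ∀ x → Reflects (P x) (⟦ f x ⟧ h)) where

  ⋀-reflects : ∀ xs → Reflects (All P xs) (⟦ ⋀ (map f xs) ⟧ h)
  ⋀-reflects []       = ofʸ []
  ⋀-reflects (x ∷ xs) = reflects-⇔ (mk⇔ (uncurry _∷_) All.uncons) (f-reflects x ×-reflects ⋀-reflects xs)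

  ⋁-reflects : ∀ xs → Reflects (Any P xs) (⟦ ⋁ (map f xs) ⟧ h)
  ⋁-reflects []       = ofⁿ λ ()
  ⋁-reflects (x ∷ xs) = reflects-⇔ (mk⇔ Any.fromSum Any.toSum) (f-reflects x ⊎-reflects ⋁-reflects xs)

IN-reflects : ∀ l → Reflects (l ≡ IN) (isIN l)
IN-reflects IN  = ofʸ refl
IN-reflects OUT = ofⁿ λ ()
IN-reflects UND = ofⁿ λ ()

OUT-reflects : ∀ l → Reflects (l ≡ OUT) (isOUT l)
OUT-reflects IN  = ofⁿ λ ()
OUT-reflects OUT = ofʸ refl
OUT-reflects UND = ofⁿ λ ()

≢OUT⇒IN⊎UND : ∀ {l} → l ≢ OUT → l ≡ IN ⊎ l ≡ UND
≢OUT⇒IN⊎UND {IN}  _     = inj₁ refl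
≢OUT⇒IN⊎UND {OUT} l≢OUT = contradiction refl l≢OUT
≢OUT⇒IN⊎UND {UND} _     = inj₂ refl

UND⇒≢IN∧≢OUT : ∀ {l} → l ≡ UND → l ≢ IN × l ≢ OUT
UND⇒≢IN∧≢OUT refl = (λ ()) , (λ ())

UND⇒≢OUT : ∀ {l} → l ≡ UND → l ≢ OUT
UND⇒≢OUT = proj₂ ∘ UND⇒≢IN∧≢OUT

≢IN∧≢OUT⇒UND : ∀ {l} → l ≢ IN → l ≢ OUT → l ≡ UND
≢IN∧≢OUT⇒UND {IN}  l≢IN _     = contradiction refl l≢IN
≢IN∧≢OUT⇒UND {OUT} _    l≢OUT = contradiction refl l≢OUT
≢IN∧≢OUT⇒UND {UND} _    _     = refl

λ[h[lab]]≗lab : (lab : Q → Label) → ∀ x → λ[ h[ lab ] ] x ≡ lab x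
λ[h[lab]]≗lab lab x with lab x
... | IN  = refl
... | OUT = refl
... | UND = refl

-- The round trip can lose information only when `pos x` and `N x` are both true: `λ[ h ]` then
-- answers `IN` and forgets `N x`. The CN condition excludes exactly this case.
h[λ[h]]≗h : {h : Assignment Q} → IsCNModel h → ∀ q → h[ λ[ h ] ] q ≡ h q
h[λ[h]]≗h {h = h} h-CN (pos x) with h (pos x) | h (N x)
... | true  | _     = refl
... | false | true  = refl
... | false | false = refl
h[λ[h]]≗h {h = h} h-CN (N x) with h (pos x) | h (N x) | h-CN x
... | true  | true  | CNx = contradiction (CNx refl) λ ()
... | true  | false | _   = refl
... | false | true  | _   = refl
... | false | false | _   = refl

h[]-isCNModel : (lab : Q → Label) → IsCNModel h[ lab ]
h[]-isCNModel lab x with lab x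
... | IN  = λ ()
... | OUT = λ _ → refl
... | UND = λ _ → refl

-- Quantification over attackers, and its reduction to finite listings.

module _ (𝒜 : JointAttackNetwork a ℓ r) where
  open JointAttackNetwork 𝒜

  -- For suitable `P` these unfold to the clauses of `IsLegitimate`. They range over all attacking
  -- predicates, not just the listed ones.
  EveryAttackerMeets SomeAttackerWithin : Pred S p → S → Set _
  EveryAttackerMeets P x = ∀ G → G R₀ x → ∃ λ y → y ∈ G × P y
  SomeAttackerWithin P x = ∃ λ G → G R₀ x × (∀ y → y ∈ G → P y)

  within-mono : {P : Pred S p} {Q : Pred S q} → P ⊆ Q →
                SomeAttackerWithin P ⊆ SomeAttackerWithin Q
  within-mono P⊆Q (G , GRx , G⊆P) = G , GRx , λ y y∈G → P⊆Q (G⊆P y y∈G)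

  module _ (fin : Finitary 𝒜) where
    open Finitary fin

    attackerElements : ∀ {x} → Attacker x → List S
    attackerElements (_ , GRx) = elements GRx

    module _ {P : Pred S p} (x : S) where

      -- An attacker `G` occurs in the listing only up to `≐`, so from left to right the witness is
      -- found in a listed copy `H` and carried back along `G ≐ H`. The converse is immediate, since
      -- listed entries are attackers. In `within⇔` the two directions exchange these roles.
      meets⇔ : All (Any P ∘ attackerElements) (attackers x) ⇔ EveryAttackerMeets P x
      meets⇔ = mk⇔ sound complete
        where
        sound : All (Any P ∘ attackerElements) (attackers x) → EveryAttackerMeets P x
        sound all G GRx =
          let anyP , G≐H = All.lookupAny all (attackers-complete GRx)
              y , y∈ys , Py = find anyP
          in y , proj₂ G≐H (proj₂ (elements-correct _) y∈ys) , Py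

        complete : EveryAttackerMeets P x → All (Any P ∘ attackerElements) (attackers x)
        complete meets = All.universal (λ (G , GRx) →
          let y , y∈G , Py = meets G GRx
          in lose (proj₁ (elements-correct GRx) y∈G) Py) (attackers x)

      within⇔ : Any (All P ∘ attackerElements) (attackers x) ⇔ SomeAttackerWithin P x
      within⇔ = mk⇔ sound complete
        where
        sound : Any (All P ∘ attackerElements) (attackers x) → SomeAttackerWithin P x
        sound any =
          let (G , GRx) , allP = Any.satisfied any
          in G , GRx , λ y y∈G → All.lookup allP (proj₁ (elements-correct GRx) y∈G)

        complete : SomeAttackerWithin P x → Any (All P ∘ attackerElements) (attackers x)
        complete (G , GRx , G⊆P) = Any.map
          (λ G≐H → All.tabulate λ y∈ys → G⊆P _ (proj₂ G≐H (proj₂ (elements-correct _) y∈ys)))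
          (attackers-complete GRx)

    -- A constructive excluded middle: a quantifier over all predicates could not be decided as
    -- such, but the listings turn it into a finite search with a decidable `P`.
    meets-or-within : {P : Pred S p} → Decidable P → ∀ x →
                      EveryAttackerMeets P x ⊎ SomeAttackerWithin (∁ P) x
    meets-or-within P? x with All.all? (Any.any? P? ∘ attackerElements) (attackers x)
    ... | yes all = inj₁ (to (meets⇔ x) all)
    ... | no ¬all = inj₂ (to (within⇔ x) (Any.map (¬Any⇒All¬ _)
                      (¬All⇒Any¬ (Any.any? P? ∘ attackerElements) (attackers x) ¬all)))

    module _ {P : Pred S p} {f : S → Formula S} {h : Assignment S}
             (f-reflects : ∀ y → Reflects (P y) (⟦ f y ⟧ h)) where

      meets-reflects : ∀ x → Reflects (EveryAttackerMeets P x)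
        (⟦ ⋀-attackers 𝒜 fin x (λ A → ⋁-elements 𝒜 fin A f) ⟧ h)
      meets-reflects x = reflects-⇔ (meets⇔ x)
        (⋀-reflects (λ A → ⋁-reflects f-reflects (attackerElements A)) (attackers x))

      within-reflects : ∀ x → Reflects (SomeAttackerWithin P x)
        (⟦ ⋁-attackers 𝒜 fin x (λ A → ⋀-elements 𝒜 fin A f) ⟧ h)
      within-reflects x = reflects-⇔ (within⇔ x)
        (⋁-reflects (λ A → ⋀-reflects f-reflects (attackerElements A)) (attackers x))

  -- Legitimacy as three conditions at each point.

  module _ (lab : S → Label) where

    -- These follow the axioms connective by connective rather than the CG clauses:
    -- `lab y ≡ IN ⊎ lab y ≢ OUT` is the reading of `atom (pos z) ∨ ~ atom (N z)`, and `UND` is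
    -- expressed as neither `IN` nor `OUT`.
    OutCondition InCondition UndCondition : S → Set _
    OutCondition x = SomeAttackerWithin (λ y → lab y ≡ IN) x → lab x ≡ OUT
    InCondition  x = lab x ≡ IN ⇔ EveryAttackerMeets (λ y → lab y ≡ OUT) x
    UndCondition x = EveryAttackerMeets (λ y → lab y ≢ IN) x
                   × SomeAttackerWithin (λ y → lab y ≡ IN ⊎ lab y ≢ OUT) x
                   → lab x ≢ IN × lab x ≢ OUT

    legitimate⇒conditions : IsLegitimate 𝒜 lab →
                            ∀ x → OutCondition x × InCondition x × UndCondition x
    legitimate⇒conditions legit x = from (CG2 x) , in-condition , und-condition
      where
      open IsLegitimate legit

      in-condition : InCondition x
      in-condition = mk⇔
        (λ x-in → case to (CG1 x) x-in of λ where
          -- The separate clause of CG1 for unattacked points is absorbed: an empty conjunction over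
          -- attackers holds vacuously.
          (inj₁ unattacked) G GRx → contradiction (G , GRx) unattacked
          (inj₂ meets)            → meets)
        (from (CG1 x) ∘ inj₂)

      und-condition : UndCondition x
      und-condition (meets , within) = UND⇒≢IN∧≢OUT
        (from (CG3 x) (meets , within-mono Sum.[ inj₁ , ≢OUT⇒IN⊎UND ] within))

    conditions⇒legitimate : Finitary 𝒜 →
                            (∀ x → OutCondition x × InCondition x × UndCondition x) →
                            IsLegitimate 𝒜 lab
    conditions⇒legitimate fin conditions = record
      { CG1 = λ x → mk⇔ (inj₂ ∘ to (in-condition x))
                        (from (in-condition x) ∘ Sum.[ (λ unattacked G GRx → contradiction (G , GRx) unattacked) , id ])
      ; CG2 = λ x → mk⇔ (out⇒within x) (out-condition x)
      ; CG3 = λ x → mk⇔ (und⇒meets×within x) λ (meets , within) →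
          uncurry ≢IN∧≢OUT⇒UND (und-condition x (meets , within-mono (Sum.map₂ UND⇒≢OUT) within))
      }
      where
      out-condition : ∀ x → OutCondition x
      out-condition = proj₁ ∘ conditions

      in-condition : ∀ x → InCondition x
      in-condition = proj₁ ∘ proj₂ ∘ conditions

      und-condition : ∀ x → UndCondition x
      und-condition = proj₂ ∘ proj₂ ∘ conditions

      IN? : ∀ y → Dec (lab y ≡ IN)
      IN? y = _ because IN-reflects (lab y)

      meets-≢IN-or-within-IN : ∀ x → EveryAttackerMeets (λ y → lab y ≢ IN) x
                                   ⊎ SomeAttackerWithin (λ y → lab y ≡ IN) x
      meets-≢IN-or-within-IN x =
        -- Splitting on the complement of `IN` leaves a double negation in the second alternative,
        -- which decidability of `IN` removes.
        Sum.map₂ (within-mono (decidable-stable (IN? _))) (meets-or-within fin (¬? ∘ IN?) x)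

      meets-OUT-or-within-≢OUT : ∀ x → EveryAttackerMeets (λ y → lab y ≡ OUT) x
                                     ⊎ SomeAttackerWithin (λ y → lab y ≢ OUT) x
      meets-OUT-or-within-≢OUT = meets-or-within fin λ y → _ because OUT-reflects (lab y)

      -- If no attacker lies within `IN`, every attacker meets its complement. Then either every
      -- attacker meets `OUT`, which makes `x` `IN`, or some attacker avoids `OUT`, and the
      -- und-condition forbids `OUT`.
      out⇒within : ∀ x → lab x ≡ OUT → SomeAttackerWithin (λ y → lab y ≡ IN) x
      out⇒within x x-out with meets-≢IN-or-within-IN x | meets-OUT-or-within-≢OUT x
      ... | inj₂ within | _           = within
      ... | inj₁ _      | inj₁ meets  =
        contradiction (trans (sym (from (in-condition x) meets)) x-out) λ ()
      ... | inj₁ meets  | inj₂ within =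
        contradiction x-out (proj₂ (und-condition x (meets , within-mono inj₂ within)))

      -- The same two dichotomies: an attacker within `IN` would make `x` `OUT`, and `OUT` met by
      -- all attackers would make it `IN`. What remains is the claim.
      und⇒meets×within : ∀ x → lab x ≡ UND →
        EveryAttackerMeets (λ y → lab y ≢ IN) x × SomeAttackerWithin (λ y → lab y ≡ IN ⊎ lab y ≡ UND) x
      und⇒meets×within x x-und with meets-≢IN-or-within-IN x | meets-OUT-or-within-≢OUT x
      ... | inj₁ meets  | inj₂ within = meets , within-mono ≢OUT⇒IN⊎UND within
      ... | inj₂ within | _           =
        contradiction (trans (sym (out-condition x within)) x-und) λ ()
      ... | inj₁ _      | inj₁ meets  =
        contradiction (trans (sym (from (in-condition x) meets)) x-und) λ ()

    -- The axioms evaluated at `h[ lab ]`.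

    module _ (fin : Finitary 𝒜) where

      private
        IN-reflects′ : ∀ y → Reflects (lab y ≡ IN) (h[ lab ] (pos y))
        IN-reflects′ y = IN-reflects (lab y)

        OUT-reflects′ : ∀ y → Reflects (lab y ≡ OUT) (h[ lab ] (N y))
        OUT-reflects′ y = OUT-reflects (lab y)

      out-reflects : ∀ x → Reflects (OutCondition x)
        (⟦ ⋁-attackers 𝒜 fin x (λ A → ⋀-elements 𝒜 fin A λ z → atom (pos z)) ⇒ atom (N x) ⟧ h[ lab ])
      out-reflects x = within-reflects fin IN-reflects′ x →-reflects OUT-reflects′ x

      in-reflects : ∀ x → Reflects (InCondition x)
        (⟦ atom (pos x) ⇔ᶠ ⋀-attackers 𝒜 fin x (λ A → ⋁-elements 𝒜 fin A λ z → atom (N z)) ⟧ h[ lab ])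
      in-reflects x = IN-reflects′ x ⇔-reflects meets-reflects fin OUT-reflects′ x

      und-reflects : ∀ x → Reflects (UndCondition x)
        (⟦ ⋀-attackers 𝒜 fin x (λ A → ⋁-elements 𝒜 fin A λ z → ~ atom (pos z))
         ∧ ⋁-attackers 𝒜 fin x (λ A → ⋀-elements 𝒜 fin A λ z → atom (pos z) ∨ ~ atom (N z))
         ⇒ ~ atom (pos x) ∧ ~ atom (N x) ⟧ h[ lab ])
      und-reflects x =
        (meets-reflects fin (¬-reflects ∘ IN-reflects′) x
          ×-reflects within-reflects fin (λ y → IN-reflects′ y ⊎-reflects ¬-reflects (OUT-reflects′ y)) x)
        →-reflects (¬-reflects (IN-reflects′ x) ×-reflects ¬-reflects (OUT-reflects′ x))

      -- One equivalence serves both directions of the theorem: it is read backwards at `λ[ h ]` and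
      -- forwards at a given legitimate labelling.
      legitimate⇔Δ : IsLegitimate 𝒜 lab ⇔ (∀ φ → φ ∈ Δ 𝒜 fin → h[ lab ] ⊨ φ)
      legitimate⇔Δ = mk⇔ models legitimate
        where
        models : IsLegitimate 𝒜 lab → ∀ φ → φ ∈ Δ 𝒜 fin → h[ lab ] ⊨ φ
        models legit _ (out-axiom x) =
          true-reflects (out-reflects x) (proj₁ (legitimate⇒conditions legit x))
        models legit _ (in-axiom x)  =
          true-reflects (in-reflects x) (proj₁ (proj₂ (legitimate⇒conditions legit x)))
        models legit _ (und-axiom x) =
          true-reflects (und-reflects x) (proj₂ (proj₂ (legitimate⇒conditions legit x)))

        legitimate : (∀ φ → φ ∈ Δ 𝒜 fin → h[ lab ] ⊨ φ) → IsLegitimate 𝒜 lab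
        legitimate ⊨Δ = conditions⇒legitimate fin λ x →
            reflects-true (out-reflects x) (⊨Δ _ (out-axiom x))
          , reflects-true (in-reflects x)  (⊨Δ _ (in-axiom x))
          , reflects-true (und-reflects x) (⊨Δ _ (und-axiom x))

theorem20 : ∀ {a ℓ r : Level} (𝒜 : JointAttackNetwork a ℓ r) (fin : Finitary 𝒜) →
    let open JointAttackNetwork 𝒜 in
    (∀ (h : Assignment S) → h IsCNModelOf Δ 𝒜 fin → IsLegitimate 𝒜 λ[ h ])
    × (∀ (lab : S → Label) → IsLegitimate 𝒜 lab → h[ lab ] IsCNModelOf Δ 𝒜 fin)
    × (∀ (h : Assignment S) → h IsCNModelOf Δ 𝒜 fin → ∀ p → h[ λ[ h ] ] p ≡ h p)
    × (∀ (lab : S → Label) → IsLegitimate 𝒜 lab → ∀ x → λ[ h[ lab ] ] x ≡ lab x)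
theorem20 𝒜 fin =
    -- The equivalence speaks of `h[ λ[ h ] ]`, so the truth of each axiom is first moved there from
    -- `h`, which the CN condition permits.
    (λ h (h-CN , h⊨Δ) → from (legitimate⇔Δ 𝒜 λ[ h ] fin) λ φ φ∈Δ →
      trans (⟦ φ ⟧-cong (h[λ[h]]≗h h-CN)) (h⊨Δ φ φ∈Δ))
  , (λ lab legit → h[]-isCNModel lab , to (legitimate⇔Δ 𝒜 lab fin) legit)
  , (λ h (h-CN , _) → h[λ[h]]≗h h-CN)
  , (λ lab _ → λ[h[lab]]≗lab lab)
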